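{- $C_3(22) = 9$.
   Context: For positive integers $m, r$, $C_m(r)$ is the minimum odd positive integer $n$ such that there exist vectors $v_1, \ldots, v_n \in \mathbb{Z}^m$ (not necessarily distinct) with $|v_i| = \sqrt{r}$ (Euclidean norm) for every $i$ and $v_1 + \cdots + v_n = \mathbf{0}$; if no such odd $n$ exists, $C_m(r) = 0$. -}

module Defs where

open import Data.Nat using (ℕ; _%_; _≤_; NonZero)
open import Data.Nat.Properties using (≤-antisym)
open import Data.Integer using (ℤ; +_; 0ℤ; _+_; _*_)
open import Data.Vec using (Vec; map; zipWith; foldr′; replicate)
open import Data.Vec.Relation.Unary.All using (All)
open import Data.Product using (_×_; _,_; ∃-syntax)
open import Data.Empty using (⊥-elim)
open import Relation.Nullary using (¬_)
open import Relation.Unary using (Pred)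
open import Relation.Binary.PropositionalEquality using (_≡_; refl)
open import Level using (0ℓ)

infixl 6 _+ᵥ_

_+ᵥ_ : ∀ {m} → Vec ℤ m → Vec ℤ m → Vec ℤ m
_+ᵥ_ = zipWith _+_

0ᵥ : ∀ {m} → Vec ℤ m
0ᵥ {m} = replicate m 0ℤ

sumᵥ : ∀ {m n} → Vec (Vec ℤ m) n → Vec ℤ m
sumᵥ = foldr′ _+ᵥ_ 0ᵥ

∥_∥² : ∀ {m} → Vec ℤ m → ℤ
∥ v ∥² = foldr′ _+_ 0ℤ (map (λ x → x * x) v)

-- |v| = √r for the Euclidean norm is expressed as ∥ v ∥² ≡ + r.
ZeroSum : (m r n : ℕ) → Set
ZeroSum m r n =
  ∃[ vs ] All (λ (v : Vec ℤ m) → ∥ v ∥² ≡ + r) {n} vs × sumᵥ vs ≡ 0ᵥ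

-- Positivity of n follows from its oddness.
OddZeroSum : (m r : ℕ) → Pred ℕ 0ℓ
OddZeroSum m r n = n % 2 ≡ 1 × ZeroSum m r n

IsMinimum : Pred ℕ 0ℓ → Pred ℕ 0ℓ
IsMinimum P n = P n × (∀ k → P k → n ≤ k)

-- C[ m , r ]≡ c says C_m(r) = c; by C-unique it determines c.
-- It is a relation because evaluating C_m(r) as a function on all m and r
-- would require deciding whether an odd zero sum exists.
data C[_,_]≡_ (m r : ℕ) .{{_ : NonZero m}} .{{_ : NonZero r}} : ℕ → Set where
  minimum : ∀ {n} → IsMinimum (OddZeroSum m r) n → C[ m , r ]≡ n
  none    : (∀ n → ¬ OddZeroSum m r n) → C[ m , r ]≡ 0

C-unique : ∀ {m r c d} .{{_ : NonZero m}} .{{_ : NonZero r}} →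
           C[ m , r ]≡ c → C[ m , r ]≡ d → c ≡ d
C-unique (minimum (p , p-min)) (minimum (q , q-min)) = ≤-antisym (p-min _ q) (q-min _ p)
C-unique (minimum (p , _))     (none ¬p)             = ⊥-elim (¬p _ p)
C-unique (none ¬p)             (minimum (p , _))     = ⊥-elim (¬p _ p)
C-unique (none _)              (none _)              = refl

{-# OPTIONS --safe #-}
-- The only way to write 22 as a sum of three squares is 9 + 9 + 4, so every
-- vector has exactly one coordinate ±2 and two coordinates ±3.  In each column
-- a zero sum forces the number of ±3 to be even, so, n being odd, the number
-- of ±2 is odd.  It is not 1, since ±2 plus a multiple of 3 is nonzero.  Hence
-- each of the three columns contains at least three ±2, and n ≥ 3 + 3 + 3.
module Submission where

open import Data.Nat
open import Defs
import Data.Nat.Divisibility as ℕ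
open import Data.Nat.Properties
  using (allUpTo?; _≟_; ≰⇒>; ≤-trans; *-mono-≤; +-mono-≤; m≤m+n; m≤n+m; ≤-reflexive)
open import Data.Nat.Tactic.RingSolver using (solve-∀)
open import Data.Integer using (ℤ; +_; -[1+_]; 0ℤ; ∣_∣) renaming (_+_ to _+ℤ_; _*_ to _*ℤ_)
open import Data.Integer.Properties using (pos-*; pos-+; +-injective)
open import Data.Integer.Divisibility.Signed using (_∣_; divides; _∣?_; ∣m∣n⇒∣m+n; ∣m+n∣m⇒∣n; ∣m+n∣n⇒∣m; ∣⇒∣ᵤ)
import Data.Integer.Tactic.RingSolver as ℤ-Solver
open import Data.Fin using (Fin; zero; suc)
open import Data.Vec using (Vec; []; _∷_; map; foldr′; lookup; sum)
open import Data.Vec.Properties using (lookup-zipWith; lookup-replicate)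
open import Data.Vec.Relation.Unary.All using (All; []; _∷_)
import Data.Vec.Relation.Unary.All as All
import Data.Vec.Relation.Unary.All.Properties as All
open import Data.Product using (_×_; _,_; proj₁; proj₂)
open import Data.Sum using (_⊎_; inj₁; inj₂)
open import Function using (Equivalence)
open import Relation.Nullary using (¬_; contradiction)
open import Relation.Nullary.Decidable using (toWitness; toWitnessFalse; _×-dec_; _⊎-dec_; _→-dec_)
open import Relation.Binary.PropositionalEquality using (_≡_; refl; sym; trans; cong; cong₂; subst)

TwoOrThree : ℕ → Set
TwoOrThree a = a ≡ 2 ⊎ a ≡ 3

-- On entries ±2, ±3 this counts the entries ±2.
twos : ∀ {n} → Vec ℤ n → ℕ
twos xs = sum (map (λ x → 3 ∸ ∣ x ∣) xs)

sumℤ : ∀ {n} → Vec ℤ n → ℤ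
sumℤ = foldr′ _+ℤ_ 0ℤ

column : ∀ {m n} → Fin m → Vec (Vec ℤ m) n → Vec ℤ n
column i = map (λ v → lookup v i)

lookup-sumᵥ : ∀ {m n} (i : Fin m) (vs : Vec (Vec ℤ m) n) →
              lookup (sumᵥ vs) i ≡ sumℤ (column i vs)
lookup-sumᵥ i []       = lookup-replicate i 0ℤ
lookup-sumᵥ i (v ∷ vs) = trans (lookup-zipWith _+ℤ_ i v (sumᵥ vs))
                               (cong (lookup v i +ℤ_) (lookup-sumᵥ i vs))

-- The last conjunct, with its trailing `+ 0`, is what `twos` unfolds to on three entries, so
-- `norm22` obtains `twos v ≡ 1` from it with no rewriting.
ThreeThreeTwo : ℕ → ℕ → ℕ → Set
ThreeThreeTwo a b c =
  (TwoOrThree a × TwoOrThree b × TwoOrThree c) × (3 ∸ a) + ((3 ∸ b) + ((3 ∸ c) + 0)) ≡ 1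

square-≤22⇒<5 : ∀ {a} → a * a ≤ 22 → a < 5
square-≤22⇒<5 a²≤22 =
  ≰⇒> λ 5≤a → contradiction (≤-trans (*-mono-≤ 5≤a 5≤a) a²≤22) (toWitnessFalse {a? = 25 ≤? 22} _)

sum-of-squares-22 : ∀ a b c → a * a + (b * b + (c * c + 0)) ≡ 22 → ThreeThreeTwo a b c
sum-of-squares-22 a b c eq = search
  (square-≤22⇒<5 (≤-trans (m≤m+n (a * a) _) (≤-reflexive eq)))
  (square-≤22⇒<5 (≤-trans (m≤m+n (b * b) _) rest≤22))
  (square-≤22⇒<5 (≤-trans (m≤m+n (c * c) _) (≤-trans (m≤n+m _ (b * b)) rest≤22)))
  eq
  where
  rest≤22 : b * b + (c * c + 0) ≤ 22
  rest≤22 = ≤-trans (m≤n+m _ (a * a)) (≤-reflexive eq)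

  twoOrThree? = λ a → (a ≟ 2) ⊎-dec (a ≟ 3)

  search : ∀ {a} → a < 5 → ∀ {b} → b < 5 → ∀ {c} → c < 5 →
           a * a + (b * b + (c * c + 0)) ≡ 22 → ThreeThreeTwo a b c
  -- Since 5 * 5 exceeds 22, only the 125 triples with entries below 5 remain; they are decided by
  -- evaluation during type checking.
  search = toWitness {a? = allUpTo? (λ a → allUpTo? (λ b → allUpTo? (λ c →
    (a * a + (b * b + (c * c + 0)) ≟ 22) →-dec
    ((twoOrThree? a ×-dec twoOrThree? b ×-dec twoOrThree? c)
      ×-dec ((3 ∸ a) + ((3 ∸ b) + ((3 ∸ c) + 0)) ≟ 1))) 5) 5) 5} _

square-∣∣ : ∀ x → x *ℤ x ≡ + (∣ x ∣ * ∣ x ∣)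
square-∣∣ (+ n)    = sym (pos-* n n)
square-∣∣ -[1+ n ] = refl

-- Signs do not affect squares, so the norm equation passes to `ℕ`, where the finite search applies.
∥∥²-∣∣ : ∀ {m} (v : Vec ℤ m) → ∥ v ∥² ≡ + sum (map (λ x → ∣ x ∣ * ∣ x ∣) v)
∥∥²-∣∣ []      = refl
∥∥²-∣∣ (x ∷ v) = trans (cong₂ _+ℤ_ (square-∣∣ x) (∥∥²-∣∣ v)) (sym (pos-+ (∣ x ∣ * ∣ x ∣) _))

norm22 : ∀ (v : Vec ℤ 3) → ∥ v ∥² ≡ + 22 →
         (∀ i → TwoOrThree ∣ lookup v i ∣) × twos v ≡ 1
norm22 v@(x ∷ y ∷ z ∷ []) ∥v∥²≡22
  with sum-of-squares-22 (∣ x ∣) (∣ y ∣) (∣ z ∣) (+-injective (trans (sym (∥∥²-∣∣ v)) ∥v∥²≡22))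
... | (p , q , r) , one = (λ { zero → p ; (suc zero) → q ; (suc (suc zero)) → r }) , one

-- Double counting: the entries ±2 are counted by columns on the left and by rows on the right,
-- where each row contributes exactly one.
twos-columns : ∀ {n} (vs : Vec (Vec ℤ 3) n) → All (λ v → twos v ≡ 1) vs →
               twos (column zero vs) + twos (column (suc zero) vs) + twos (column (suc (suc zero)) vs) ≡ n
twos-columns []                      []         = refl
twos-columns ((x ∷ y ∷ z ∷ []) ∷ vs) (one ∷ ones) =
  trans (rearrange (3 ∸ ∣ x ∣) (3 ∸ ∣ y ∣) (3 ∸ ∣ z ∣) _ _ _) (cong₂ _+_ one (twos-columns vs ones))
  where
  rearrange : ∀ a b c a′ b′ c′ →
              (a + a′) + (b + b′) + (c + c′) ≡ (a + (b + (c + 0))) + (a′ + b′ + c′)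
  rearrange = solve-∀

-- Entry by entry, `x` has the parity of `1 + (3 ∸ ∣ x ∣)`: both are even for ±2 and odd for ±3.
-- Summing, the 1s add up to `n` and the rest to `twos xs`.
sumℤ-parity : ∀ {n} (xs : Vec ℤ n) → All (λ x → TwoOrThree ∣ x ∣) xs →
              + 2 ∣ sumℤ xs +ℤ + (twos xs + n)
sumℤ-parity []       []       = divides 0ℤ refl
sumℤ-parity {suc n} (x ∷ xs) (p ∷ ps) =
  subst (+ 2 ∣_) regroup (∣m∣n⇒∣m+n (entry x p) (sumℤ-parity xs ps))
  where
  entry : ∀ x → TwoOrThree ∣ x ∣ → + 2 ∣ x +ℤ + (1 + (3 ∸ ∣ x ∣))
  entry (+ _)    (inj₁ refl) = toWitness {a? = + 2 ∣? + 4} _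
  entry (+ _)    (inj₂ refl) = toWitness {a? = + 2 ∣? + 4} _
  entry -[1+ _ ] (inj₁ refl) = toWitness {a? = + 2 ∣? 0ℤ} _
  entry -[1+ _ ] (inj₂ refl) = toWitness {a? = + 2 ∣? -[1+ 1 ]} _

  interchange : ∀ a b c d → (a +ℤ b) +ℤ (c +ℤ d) ≡ (a +ℤ c) +ℤ (b +ℤ d)
  interchange = ℤ-Solver.solve-∀

  interchangeℕ : ∀ d n t → (1 + d) + (t + n) ≡ (d + t) + suc n
  interchangeℕ = solve-∀

  regroup : (x +ℤ + (1 + (3 ∸ ∣ x ∣))) +ℤ (sumℤ xs +ℤ + (twos xs + n))
          ≡ sumℤ (x ∷ xs) +ℤ + (twos (x ∷ xs) + suc n)
  regroup = trans (interchange x _ (sumℤ xs) _)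
    (cong (λ k → (x +ℤ sumℤ xs) +ℤ + k) (interchangeℕ (3 ∸ ∣ x ∣) n (twos xs)))

3∣±3 : ∀ x → ∣ x ∣ ≡ 3 → + 3 ∣ x
3∣±3 (+ _)    refl = toWitness {a? = + 3 ∣? + 3} _
3∣±3 -[1+ _ ] refl = toWitness {a? = + 3 ∣? -[1+ 2 ]} _

3∤±2 : ∀ x → ∣ x ∣ ≡ 2 → ¬ + 3 ∣ x
3∤±2 (+ _)    refl = toWitnessFalse {a? = + 3 ∣? + 2} _
3∤±2 -[1+ _ ] refl = toWitnessFalse {a? = + 3 ∣? -[1+ 1 ]} _

twos≡0⇒3∣sumℤ : ∀ {n} (xs : Vec ℤ n) → All (λ x → TwoOrThree ∣ x ∣) xs →
                twos xs ≡ 0 → + 3 ∣ sumℤ xs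
twos≡0⇒3∣sumℤ []       []              _  = divides 0ℤ refl
twos≡0⇒3∣sumℤ (x ∷ xs) (inj₁ ∣x∣≡2 ∷ ps) eq rewrite ∣x∣≡2 = contradiction eq λ ()
twos≡0⇒3∣sumℤ (x ∷ xs) (inj₂ ∣x∣≡3 ∷ ps) eq rewrite ∣x∣≡3 =
  ∣m∣n⇒∣m+n (3∣±3 x ∣x∣≡3) (twos≡0⇒3∣sumℤ xs ps eq)

-- Modulo 3 the entries ±3 vanish, so the sum is congruent to the single ±2, which is nonzero.
twos≡1⇒3∤sumℤ : ∀ {n} (xs : Vec ℤ n) → All (λ x → TwoOrThree ∣ x ∣) xs →
                twos xs ≡ 1 → ¬ + 3 ∣ sumℤ xs
twos≡1⇒3∤sumℤ (x ∷ xs) (inj₁ ∣x∣≡2 ∷ ps) eq 3∣s rewrite ∣x∣≡2 =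
  -- The head is the only ±2, so the tail sums to a multiple of 3, and the head would have to be one
  -- as well.
  3∤±2 x ∣x∣≡2 (∣m+n∣n⇒∣m 3∣s (twos≡0⇒3∣sumℤ xs ps (cong pred eq)))
twos≡1⇒3∤sumℤ (x ∷ xs) (inj₂ ∣x∣≡3 ∷ ps) eq 3∣s rewrite ∣x∣≡3 =
  twos≡1⇒3∤sumℤ xs ps eq (∣m+n∣m⇒∣n 3∣s (3∣±3 x ∣x∣≡3))

-- With sum zero and `n` odd, parity rules out counts 0 and 2, while divisibility of the sum by 3
-- rules out count 1.
3≤twos : ∀ {n} (xs : Vec ℤ n) → All (λ x → TwoOrThree ∣ x ∣) xs →
         ¬ 2 ℕ.∣ n → sumℤ xs ≡ 0ℤ → 3 ≤ twos xs
3≤twos {n} xs ps 2∤n s≡0 = bound (twos xs) refl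
  where
  2∣twos+n : 2 ℕ.∣ twos xs + n
  2∣twos+n = ∣⇒∣ᵤ (subst (λ s → + 2 ∣ s +ℤ + (twos xs + n)) s≡0 (sumℤ-parity xs ps))

  bound : ∀ t → twos xs ≡ t → 3 ≤ t
  bound 0 eq = contradiction (subst (λ t → 2 ℕ.∣ t + n) eq 2∣twos+n) 2∤n
  bound 1 eq = contradiction (subst (+ 3 ∣_) (sym s≡0) (divides 0ℤ refl)) (twos≡1⇒3∤sumℤ xs ps eq)
  bound 2 eq = contradiction (ℕ.∣m+n∣m⇒∣n (subst (λ t → 2 ℕ.∣ t + n) eq 2∣twos+n) ℕ.∣-refl) 2∤n
  bound (suc (suc (suc t))) _ = s≤s (s≤s (s≤s z≤n))

odd⇒2∤ : ∀ {n} → n % 2 ≡ 1 → ¬ 2 ℕ.∣ n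
odd⇒2∤ {n} odd 2∣n =
  contradiction (trans (sym odd) (Equivalence.from (ℕ.m%n≡0⇔n∣m n 2) 2∣n)) λ ()

9≤length : ∀ n → OddZeroSum 3 22 n → 9 ≤ n
9≤length n (odd , vs , norms , sum≡0) =
  -- The length is replaced by the total count of ±2 over the three columns, each of which supplies
  -- at least three.
  subst (9 ≤_) (twos-columns vs (All.map (λ {v} p → proj₂ (norm22 v p)) norms))
    (+-mono-≤ (+-mono-≤ (3≤ zero) (3≤ (suc zero))) (3≤ (suc (suc zero))))
  where
  3≤ : ∀ i → 3 ≤ twos (column i vs)
  3≤ i = 3≤twos (column i vs)
    (All.map⁺ (All.map (λ {v} p → proj₁ (norm22 v p) i) norms))
    (odd⇒2∤ odd)
    (trans (sym (lookup-sumᵥ i vs))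
      (trans (cong (λ v → lookup v i) sum≡0) (lookup-replicate i 0ℤ)))

-- In each column 2 + 2 + 2 cancels two +3 and four -3.
zeroSum9 : ZeroSum 3 22 9
zeroSum9 =
  ( (2ℤ ∷ 3ℤ ∷ -3ℤ ∷ []) ∷ (2ℤ ∷ -3ℤ ∷ 3ℤ ∷ []) ∷ (2ℤ ∷ -3ℤ ∷ -3ℤ ∷ [])
  ∷ (3ℤ ∷ 2ℤ ∷ -3ℤ ∷ []) ∷ (-3ℤ ∷ 2ℤ ∷ 3ℤ ∷ []) ∷ (-3ℤ ∷ 2ℤ ∷ -3ℤ ∷ [])
  ∷ (3ℤ ∷ -3ℤ ∷ 2ℤ ∷ []) ∷ (-3ℤ ∷ 3ℤ ∷ 2ℤ ∷ []) ∷ (-3ℤ ∷ -3ℤ ∷ 2ℤ ∷ []) ∷ [] )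
  , refl ∷ refl ∷ refl ∷ refl ∷ refl ∷ refl ∷ refl ∷ refl ∷ refl ∷ []
  , refl
  where
  2ℤ 3ℤ -3ℤ : ℤ
  2ℤ  = + 2
  3ℤ  = + 3
  -3ℤ = -[1+ 2 ]

theorem4 : C[ 3 , 22 ]≡ 9
theorem4 = minimum ((refl , zeroSum9) , 9≤length)
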